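{- Let $c := \frac{4}{9-\sqrt{5}} \approx 0.5914$. There exists a deterministic online algorithm for the maximum cardinality fractional matching problem in the adversarial edge arrival model which achieves the guarantee $c$ on graphs of maximum degree three. That is, for every graph $G$ of maximum degree at most three and every order in which its edges arrive, at every timepoint the fractional matching $y$ maintained by the algorithm satisfies $\sum_{e \in E_t} y_e \geq c \cdot \nu(G_t)$, where $G_t=(V,E_t)$ is the graph formed by the edges arrived so far and $\nu(G_t)$ is the maximum cardinality of a matching in $G_t$.
   Context: Online fractional matching with adversarial edge arrivals: the edges of a graph are revealed one at a time in an order chosen by an adversary. When an edge $e$ arrives, the algorithm must immediately and irrevocably assign it a value $y_e \geq 0$, such that at every timepoint, for every vertex $w$, the sum of the values of the arrived edges incident to $w$ is at most $1$. An algorithm achieves guarantee $\gamma$ on a class of graphs if for every graph in the class and every arrival order, at every timepoint the total value $\sum_e y_e$ of the arrived edges is at least $\gamma$ times the maximum cardinality of a matching in the graph formed by the already arrived edges. "Graphs of maximum degree three" means every vertex has degree at most three (so all arrived graphs have maximum degree at most three); graphs need not be bipartite. -}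

module Defs where

open import Data.Nat as ℕ using (ℕ; _≤_)
open import Data.Integer using (+_)
open import Data.Rational as Q using (ℚ; 0ℚ; 1ℚ; _/_)
open import Data.Product using (_×_; _,_; proj₁; proj₂)
open import Data.Sum using (_⊎_)
open import Data.List using (List; []; _∷_; _++_; [_]; length; filter; take; map)
open import Data.List.Membership.Propositional using (_∈_)
open import Data.List.Relation.Unary.All using (All)
open import Data.List.Relation.Unary.AllPairs using (AllPairs)
open import Relation.Binary.PropositionalEquality using (_≡_; _≢_)
open import Relation.Nullary using (¬_; Dec; yes; no)
open import Relation.Nullary.Decidable using (_⊎-dec_)

record ℚ√5 : Set where
  constructor _+_√5
  field
    re : ℚ
    ir : ℚ
open ℚ√5 public

infixl 6 _⊕_ _⊖_
infixl 7 _⊛_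

_⊕_ : ℚ√5 → ℚ√5 → ℚ√5
(a + b √5) ⊕ (c + d √5) = (a Q.+ c) + (b Q.+ d) √5

_⊖_ : ℚ√5 → ℚ√5 → ℚ√5
(a + b √5) ⊖ (c + d √5) = (a Q.- c) + (b Q.- d) √5

_⊛_ : ℚ√5 → ℚ√5 → ℚ√5
(a + b √5) ⊛ (c + d √5) =
  (a Q.* c Q.+ (+ 5 / 1) Q.* (b Q.* d)) + (a Q.* d Q.+ b Q.* c) √5

fromℕ : ℕ → ℚ√5
fromℕ n = (+ n / 1) + 0ℚ √5

zero√5 one√5 : ℚ√5
zero√5 = 0ℚ + 0ℚ √5
one√5 = 1ℚ + 0ℚ √5

-- the real number a + b√5 is ≥ 0
NonNeg : ℚ√5 → Set
NonNeg (a + b √5) =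
    (0ℚ Q.≤ a × 0ℚ Q.≤ b)
  ⊎ (0ℚ Q.≤ a × b Q.≤ 0ℚ × (+ 5 / 1) Q.* (b Q.* b) Q.≤ a Q.* a)
  ⊎ (a Q.≤ 0ℚ × 0ℚ Q.≤ b × a Q.* a Q.≤ (+ 5 / 1) Q.* (b Q.* b))

infix 4 _≼_
_≼_ : ℚ√5 → ℚ√5 → Set
x ≼ y = NonNeg (y ⊖ x)

-- c = 4 / (9 - √5) = (9 + √5) / 19
c : ℚ√5
c = (+ 9 / 19) + (+ 1 / 19) √5

Edge : Set
Edge = ℕ × ℕ

Incident : ℕ → Edge → Set
Incident v (a , b) = v ≡ a ⊎ v ≡ b

incident? : (v : ℕ) (e : Edge) → Dec (Incident v e)
incident? v (a , b) = (v ℕ.≟ a) ⊎-dec (v ℕ.≟ b)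

degree : ℕ → List Edge → ℕ
degree v es = length (filter (incident? v) es)

SameEdge : Edge → Edge → Set
SameEdge (a , b) (c , d) = (a ≡ c × b ≡ d) ⊎ (a ≡ d × b ≡ c)

SimpleGraphSeq : List Edge → Set
SimpleGraphSeq es = All (λ e → proj₁ e ≢ proj₂ e) es
                  × AllPairs (λ e f → ¬ SameEdge e f) es

MaxDegree≤3 : List Edge → Set
MaxDegree≤3 es = ∀ v → degree v es ≤ 3

VertexDisjoint : Edge → Edge → Set
VertexDisjoint (a , b) (c , d) = a ≢ c × a ≢ d × b ≢ c × b ≢ d

IsMatching : List Edge → List Edge → Set
IsMatching G M = All (_∈ G) M × AllPairs VertexDisjoint M

-- Deterministic online algorithms: when edge e arrives, the value y_e is
-- a function of the (ordered) history of previously arrived edges and e.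

OnlineAlg : Set
OnlineAlg = List Edge → Edge → ℚ√5

run : OnlineAlg → List Edge → List (Edge × ℚ√5)
run alg = go []
  where
  go : List Edge → List Edge → List (Edge × ℚ√5)
  go hist [] = []
  go hist (e ∷ es) = (e , alg hist e) ∷ go (hist ++ [ e ]) es

total : List (Edge × ℚ√5) → ℚ√5
total [] = zero√5
total ((_ , y) ∷ ys) = y ⊕ total ys

load : ℕ → List (Edge × ℚ√5) → ℚ√5
load v [] = zero√5
load v ((e , y) ∷ ys) with incident? v e
... | yes _ = y ⊕ load v ys
... | no _ = load v ys

-- the guarantee γ at time t (after the first t edges have arrived):
-- y is a fractional matching of G_t and Σ y_e ≥ γ · ν(G_t), the latter
-- stated as: γ · |M| ≤ Σ y_e for every matching M of G_t.
GuaranteeAt : ℚ√5 → OnlineAlg → List Edge → ℕ → Set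
GuaranteeAt γ alg es t =
    All (λ p → zero√5 ≼ proj₂ p) ys
  × (∀ v → load v ys ≼ one√5)
  × (∀ M → IsMatching (take t es) M → γ ⊛ fromℕ (length M) ≼ total ys)
  where
  ys = take t (run alg es)

{-# OPTIONS --safe #-}
-- Primal-dual: every vertex v carries a dual value x_v, an arriving edge uv splits
-- its value y = p + q as x_u += p, x_v += q, and the split keeps x_u + x_v ≥ c.
-- Then Σ y = Σ x_v ≥ c |M| for every matching M.  With z_v the part of the load of v
-- credited to its neighbours (load = x + z), a vertex of degree two can afford its
-- last edge iff z ≤ 1 - c.  Attaching a new vertex to a vertex of degree one in state
-- (x , z) forces the state (1 - c - z , 2c - 1 - x + z) on the new vertex, so the states
-- of degree one must stay feasible under iteration of this affine map.  Around its fixed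
-- point it has the eigenvalues φ and -1/φ; the half-plane below the line spanned by the
-- stable direction is invariant, and c is the value for which the state (c/2 , c/2) of
-- the first edge lies on that line.
module Submission where

open import Defs
open import Algebra.Bundles using (CommutativeRing)
import Algebra.Solver.Ring.AlmostCommutativeRing as ACR
import Algebra.Solver.Ring.Simple as RingSolver
open import Data.Empty using (⊥-elim)
open import Data.Integer as ℤ using (+_; -[1+_])
import Data.Integer.Properties as ℤP
open import Data.List using (List; []; _∷_; _++_; [_]; length; take; drop; foldl)
open import Data.List.Membership.Propositional using (_∈_)
open import Data.List.Properties using (++-assoc; ++-identityʳ; filter-accept; filter-reject)
open import Data.List.Relation.Unary.All as All using (All; []; _∷_)
import Data.List.Relation.Unary.All.Properties as AllP
open import Data.List.Relation.Unary.AllPairs using (AllPairs; []; _∷_)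
open import Data.List.Relation.Unary.Any using (here; there)
open import Data.List.Relation.Unary.Unique.Propositional using (Unique)
open import Data.Nat as ℕ using (ℕ; zero; suc; z≤n; s≤s)
import Data.Nat.Properties as ℕP
open import Data.Product using (Σ; _×_; _,_; proj₁; proj₂; swap)
open import Data.Rational as Q using (ℚ; 0ℚ; 1ℚ; _/_; _+_; _*_; _-_; -_; _≤_; _<_)
import Data.Rational.Properties as QP
import Data.Rational.Solver as ℚSolver
import Data.Rational.Unnormalised as ℚᵘ
import Data.Rational.Unnormalised.Properties as ℚᵘP
open import Data.Sum using (_⊎_; inj₁; inj₂)
open import Data.Unit using (⊤; tt)
open import Function using (const; _∘_)
open import Relation.Binary.Definitions using (DecidableEquality)
open import Relation.Binary.PropositionalEquality using (_≡_; _≢_; refl; sym; trans; cong; cong₂; subst; subst₂; ≢-sym; isEquivalence; module ≡-Reasoning)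
open import Algebra.Definitions {A = ℚ√5} _≡_ using (Associative; Commutative; LeftIdentity; RightIdentity; LeftInverse; RightInverse; _DistributesOverˡ_; _DistributesOverʳ_)
open import Relation.Nullary using (Dec; yes; no; ¬_)
open import Relation.Nullary.Decidable using (True; map′; toWitness; _×-dec_; _⊎-dec_)

open ℚSolver.+-*-Solver using () renaming (solve to solveℚ; _:=_ to _≐_; con to κ; _:+_ to _⊞_; _:*_ to _⊠_; _:-_ to _⊟_; :-_ to ⊟_)

-- The ordered field ℚ√5

five : ℚ
five = + 5 / 1

0≤+ : ∀ {p q} → 0ℚ ≤ p → 0ℚ ≤ q → 0ℚ ≤ p + q
0≤+ = QP.+-mono-≤

0≤* : ∀ {p q} → 0ℚ ≤ p → 0ℚ ≤ q → 0ℚ ≤ p * q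
0≤* {p} {q} 0≤p 0≤q =
  QP.nonNegative⁻¹ (p * q) {{QP.nonNeg*nonNeg⇒nonNeg p {{Q.nonNegative 0≤p}} q {{Q.nonNegative 0≤q}}}}

0≤-via : ∀ {p q} → p ≡ q → 0ℚ ≤ q → 0ℚ ≤ p
0≤-via eq = subst (0ℚ ≤_) (sym eq)

≤⇒0≤- : ∀ {p q} → p ≤ q → 0ℚ ≤ q - p
≤⇒0≤- {p} {q} p≤q = subst (_≤ q - p) (QP.+-inverseʳ p) (QP.+-monoˡ-≤ (- p) p≤q)

0≤-⇒≤ : ∀ {p q} → 0ℚ ≤ q - p → p ≤ q
0≤-⇒≤ {p} {q} 0≤q-p = subst (p ≤_) (solveℚ 2 (λ p q → p ⊞ (q ⊟ p) ≐ q) refl p q)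
  (subst (_≤ p + (q - p)) (QP.+-identityʳ p) (QP.+-monoʳ-≤ p 0≤q-p))

≤0⇒0≤- : ∀ {p} → p ≤ 0ℚ → 0ℚ ≤ - p
≤0⇒0≤- = QP.neg-antimono-≤

0≤-square : ∀ p → 0ℚ ≤ p * p
0≤-square p with QP.≤-total 0ℚ p
... | inj₁ 0≤p = 0≤* 0≤p 0≤p
... | inj₂ p≤0 = 0≤-via (solveℚ 1 (λ p → p ⊠ p ≐ (⊟ p) ⊠ (⊟ p))
    refl p) (0≤* (≤0⇒0≤- p≤0) (≤0⇒0≤- p≤0))

*-mono-≤-0≤ : ∀ {p q r s} → 0ℚ ≤ p → 0ℚ ≤ s → p ≤ q → r ≤ s → p * r ≤ q * s
*-mono-≤-0≤ {p} {q} {r} {s} 0≤p 0≤s p≤q r≤s = 0≤-⇒≤ (0≤-via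
  (solveℚ 4 (λ p q r s → q ⊠ s ⊟ p ⊠ r ≐ p ⊠ (s ⊟ r) ⊞ (q ⊟ p) ⊠ s) refl p q r s)
  (0≤+ (0≤* 0≤p (≤⇒0≤- r≤s)) (0≤* (≤⇒0≤- p≤q) 0≤s)))

*-mono-<-0≤ : ∀ {p q} → 0ℚ ≤ p → p < q → p * p < q * q
*-mono-<-0≤ {p} {q} 0≤p p<q = QP.≤-<-trans
  (*-mono-≤-0≤ 0≤p (QP.<⇒≤ (QP.≤-<-trans 0≤p p<q)) QP.≤-refl (QP.<⇒≤ p<q))
  (QP.*-monoˡ-<-pos q {{Q.positive (QP.≤-<-trans 0≤p p<q)}} p<q)

square-cancel-≤ : ∀ {p q} → 0ℚ ≤ q → p * p ≤ q * q → p ≤ q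
square-cancel-≤ {p} {q} 0≤q p²≤q² with p QP.≤? q
... | yes p≤q = p≤q
... | no p≰q = ⊥-elim (QP.<-irrefl refl (QP.<-≤-trans (*-mono-<-0≤ 0≤q (QP.≰⇒> p≰q)) p²≤q²))

-- The hypotheses say ∣p∣ ≤ q. Comparisons with √5 are only available squared, so the cross terms
-- below get their signs from here.
square-dominated : ∀ {p q} → 0ℚ ≤ q → p * p ≤ q * q → 0ℚ ≤ q + p
square-dominated {p} {q} 0≤q p²≤q² = 0≤-via
  (cong (λ r → q + r) (solveℚ 1 (λ p → p ≐ ⊟ (⊟ p)) refl p))
  (≤⇒0≤- (square-cancel-≤ 0≤q
    (subst (_≤ q * q) (solveℚ 1 (λ p → p ⊠ p ≐ (⊟ p) ⊠ (⊟ p)) refl p) p²≤q²)))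

infix 8 ⊝_
⊝_ : ℚ√5 → ℚ√5
⊝ (a + b √5) = (- a) + (- b) √5

-- NonNeg regrouped as a ≥ √5 ∣b∣ or √5 b ≥ ∣a∣, two halves that multiplication by √5 exchanges.
data Cone : ℚ√5 → Set where
  re-dominant : ∀ {a b} → 0ℚ ≤ a → five * (b * b) ≤ a * a → Cone (a + b √5)
  ir-dominant : ∀ {a b} → 0ℚ ≤ b → a * a ≤ five * (b * b) → Cone (a + b √5)

quadrant : ∀ {a b} → 0ℚ ≤ a → 0ℚ ≤ b → Cone (a + b √5)
quadrant {a} {b} 0≤a 0≤b with QP.≤-total (five * (b * b)) (a * a)
... | inj₁ le = re-dominant 0≤a le
... | inj₂ le = ir-dominant 0≤b le

toCone : ∀ {x} → NonNeg x → Cone x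
toCone (inj₁ (0≤a , 0≤b)) = quadrant 0≤a 0≤b
toCone (inj₂ (inj₁ (0≤a , _ , le))) = re-dominant 0≤a le
toCone (inj₂ (inj₂ (_ , 0≤b , le))) = ir-dominant 0≤b le

fromCone : ∀ {x} → Cone x → NonNeg x
fromCone {a + b √5} (re-dominant 0≤a le) with QP.≤-total 0ℚ b
... | inj₁ 0≤b = inj₁ (0≤a , 0≤b)
... | inj₂ b≤0 = inj₂ (inj₁ (0≤a , b≤0 , le))
fromCone {a + b √5} (ir-dominant 0≤b le) with QP.≤-total 0ℚ a
... | inj₁ 0≤a = inj₁ (0≤a , 0≤b)
... | inj₂ a≤0 = inj₂ (inj₂ (a≤0 , 0≤b , le))

cone-total : ∀ x → Cone x ⊎ Cone (⊝ x)
cone-total (a + b √5) with QP.≤-total (five * (b * b)) (a * a) | QP.≤-total 0ℚ a | QP.≤-total 0ℚ b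
... | inj₁ le | inj₁ 0≤a | _ = inj₁ (re-dominant 0≤a le)
... | inj₁ le | inj₂ a≤0 | _ = inj₂ (re-dominant (≤0⇒0≤- a≤0)
  (0≤-⇒≤ (0≤-via (solveℚ 3 (λ a b f → (⊟ a) ⊠ (⊟ a) ⊟ f ⊠ ((⊟ b) ⊠ (⊟ b)) ≐ a ⊠ a ⊟ f ⊠ (b ⊠ b))
      refl a b five) (≤⇒0≤- le))))
... | inj₂ le | _ | inj₁ 0≤b = inj₁ (ir-dominant 0≤b le)
... | inj₂ le | _ | inj₂ b≤0 = inj₂ (ir-dominant (≤0⇒0≤- b≤0)
  (0≤-⇒≤ (0≤-via (solveℚ 3 (λ a b f → f ⊠ ((⊟ b) ⊠ (⊟ b)) ⊟ (⊟ a) ⊠ (⊟ a) ≐ f ⊠ (b ⊠ b) ⊟ a ⊠ a)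
      refl a b five) (≤⇒0≤- le))))

0≤five : 0ℚ ≤ five
0≤five = QP.nonNegative⁻¹ five

five-cancel : ∀ {p} → 0ℚ ≤ five * p → 0ℚ ≤ p
five-cancel {p} le = 0≤-via
  (solveℚ 1 (λ p → p ≐ κ (+ 1 / 5) ⊠ (κ five ⊠ p)) refl p)
  (0≤* (QP.nonNegative⁻¹ (+ 1 / 5)) le)

-- Multiplying √5 ∣b∣ ≤ a by √5 ∣b′∣ ≤ a′ bounds 5 ∣b b′∣ by a a′.
cross-re : ∀ a b a′ b′ → 0ℚ ≤ a → 0ℚ ≤ a′ → five * (b * b) ≤ a * a → five * (b′ * b′) ≤ a′ * a′ →
  0ℚ ≤ a * a′ + five * (b * b′)
cross-re a b a′ b′ 0≤a 0≤a′ le le′ = square-dominated (0≤* 0≤a 0≤a′) (begin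
  (five * (b * b′)) * (five * (b * b′)) ≡⟨ solveℚ 3 (λ b b′ f → (f ⊠ (b ⊠ b′)) ⊠ (f ⊠ (b ⊠ b′)) ≐
      (f ⊠ (b ⊠ b)) ⊠ (f ⊠ (b′ ⊠ b′))) refl b b′ five ⟩
  (five * (b * b)) * (five * (b′ * b′)) ≤⟨ *-mono-≤-0≤ (0≤* 0≤five (0≤-square b)) (0≤-square a′) le le′ ⟩
  (a * a) * (a′ * a′) ≡⟨ solveℚ 2 (λ a b → (a ⊠ a) ⊠ (b ⊠ b) ≐ (a ⊠ b) ⊠ (a ⊠ b)) refl a a′ ⟩
  (a * a′) * (a * a′) ∎)
  where open QP.≤-Reasoning

cross-ir : ∀ a b a′ b′ → 0ℚ ≤ b → 0ℚ ≤ b′ → a * a ≤ five * (b * b) → a′ * a′ ≤ five * (b′ * b′) →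
  0ℚ ≤ five * (b * b′) + a * a′
cross-ir a b a′ b′ 0≤b 0≤b′ le le′ = square-dominated (0≤* 0≤five (0≤* 0≤b 0≤b′)) (begin
  (a * a′) * (a * a′) ≡⟨ solveℚ 2 (λ a b → (a ⊠ b) ⊠ (a ⊠ b) ≐ (a ⊠ a) ⊠ (b ⊠ b)) refl a a′ ⟩
  (a * a) * (a′ * a′) ≤⟨ *-mono-≤-0≤ (0≤-square a) (0≤* 0≤five (0≤-square b′)) le le′ ⟩
  (five * (b * b)) * (five * (b′ * b′)) ≡⟨ solveℚ 3 (λ b b′ f → (f ⊠ (b ⊠ b)) ⊠ (f ⊠ (b′ ⊠ b′)) ≐
      (f ⊠ (b ⊠ b′)) ⊠ (f ⊠ (b ⊠ b′))) refl b b′ five ⟩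
  (five * (b * b′)) * (five * (b * b′)) ∎)
  where open QP.≤-Reasoning

-- Multiplication by √5 turns a′ + b′√5 into the `re-dominant` 5 b′ + a′√5, so `cross-re` applies;
-- its conclusion carries a factor 5.
cross-mixed : ∀ a b a′ b′ → 0ℚ ≤ a → 0ℚ ≤ b′ → five * (b * b) ≤ a * a →
    a′ * a′ ≤ five * (b′ * b′) →
  0ℚ ≤ a * b′ + b * a′
cross-mixed a b a′ b′ 0≤a 0≤b′ le le′ = five-cancel (0≤-via
  (solveℚ 5 (λ a b a′ b′ f → f ⊠ (a ⊠ b′ ⊞ b ⊠ a′) ≐ a ⊠ (f ⊠ b′) ⊞ f ⊠ (b ⊠ a′))
      refl a b a′ b′ five)
  (cross-re a b (five * b′) a′ 0≤a (0≤* 0≤five 0≤b′) le (begin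
    five * (a′ * a′) ≤⟨ *-mono-≤-0≤ 0≤five (0≤* 0≤five (0≤-square b′)) QP.≤-refl le′ ⟩
    five * (five * (b′ * b′)) ≡⟨ solveℚ 2 (λ b f → f ⊠ (f ⊠ (b ⊠ b)) ≐ (f ⊠ b) ⊠ (f ⊠ b))
        refl b′ five ⟩
    (five * b′) * (five * b′) ∎)))
  where open QP.≤-Reasoning

-- The norm a² - 5 b² is multiplicative: the signs of the two norms decide the half of the product,
-- and a cross term gives the sign of its dominant coordinate.
cone-* : ∀ {x y} → Cone x → Cone y → Cone (x ⊛ y)
cone-* {a + b √5} {a′ + b′ √5} (re-dominant 0≤a le) (re-dominant 0≤a′ le′) =
  re-dominant (cross-re a b a′ b′ 0≤a 0≤a′ le le′) (0≤-⇒≤ (0≤-via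
    (solveℚ 5 (λ a b a′ b′ f → (a ⊠ a′ ⊞ f ⊠ (b ⊠ b′)) ⊠ (a ⊠ a′ ⊞ f ⊠ (b ⊠ b′)) ⊟ f ⊠ ((a ⊠ b′ ⊞ b ⊠ a′) ⊠ (a ⊠ b′ ⊞ b ⊠ a′))
       ≐ (a ⊠ a ⊟ f ⊠ (b ⊠ b)) ⊠ (a′ ⊠ a′ ⊟ f ⊠ (b′ ⊠ b′))) refl a b a′ b′ five)
    (0≤* (≤⇒0≤- le) (≤⇒0≤- le′))))
cone-* {a + b √5} {a′ + b′ √5} (ir-dominant 0≤b le) (ir-dominant 0≤b′ le′) =
  re-dominant (0≤-via (QP.+-comm (a * a′) (five * (b * b′))) (cross-ir a b a′ b′ 0≤b 0≤b′ le le′)) (0≤-⇒≤ (0≤-via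
    (solveℚ 5 (λ a b a′ b′ f → (a ⊠ a′ ⊞ f ⊠ (b ⊠ b′)) ⊠ (a ⊠ a′ ⊞ f ⊠ (b ⊠ b′)) ⊟ f ⊠ ((a ⊠ b′ ⊞ b ⊠ a′) ⊠ (a ⊠ b′ ⊞ b ⊠ a′))
       ≐ (f ⊠ (b ⊠ b) ⊟ a ⊠ a) ⊠ (f ⊠ (b′ ⊠ b′) ⊟ a′ ⊠ a′)) refl a b a′ b′ five)
    (0≤* (≤⇒0≤- le) (≤⇒0≤- le′))))
cone-* {a + b √5} {a′ + b′ √5} (re-dominant 0≤a le) (ir-dominant 0≤b′ le′) =
  ir-dominant (cross-mixed a b a′ b′ 0≤a 0≤b′ le le′) (0≤-⇒≤ (0≤-via
    (solveℚ 5 (λ a b a′ b′ f → f ⊠ ((a ⊠ b′ ⊞ b ⊠ a′) ⊠ (a ⊠ b′ ⊞ b ⊠ a′)) ⊟ (a ⊠ a′ ⊞ f ⊠ (b ⊠ b′)) ⊠ (a ⊠ a′ ⊞ f ⊠ (b ⊠ b′))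
       ≐ (a ⊠ a ⊟ f ⊠ (b ⊠ b)) ⊠ (f ⊠ (b′ ⊠ b′) ⊟ a′ ⊠ a′)) refl a b a′ b′ five)
    (0≤* (≤⇒0≤- le) (≤⇒0≤- le′))))
cone-* {a + b √5} {a′ + b′ √5} (ir-dominant 0≤b le) (re-dominant 0≤a′ le′) =
  ir-dominant (0≤-via (solveℚ 4 (λ a b a′ b′ → a ⊠ b′ ⊞ b ⊠ a′ ≐ a′ ⊠ b ⊞ b′ ⊠ a) refl a b a′ b′)
      (cross-mixed a′ b′ a b 0≤a′ 0≤b le′ le)) (0≤-⇒≤ (0≤-via
    (solveℚ 5 (λ a b a′ b′ f → f ⊠ ((a ⊠ b′ ⊞ b ⊠ a′) ⊠ (a ⊠ b′ ⊞ b ⊠ a′)) ⊟ (a ⊠ a′ ⊞ f ⊠ (b ⊠ b′)) ⊠ (a ⊠ a′ ⊞ f ⊠ (b ⊠ b′))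
       ≐ (f ⊠ (b ⊠ b) ⊟ a ⊠ a) ⊠ (a′ ⊠ a′ ⊟ f ⊠ (b′ ⊠ b′))) refl a b a′ b′ five)
    (0≤* (≤⇒0≤- le) (≤⇒0≤- le′))))

-- When the coordinates of the sum have opposite signs, its norm is compared with 0 by
-- totality: in the unwanted case the negated sum lies in the same half of the cone as one
-- summand, and their cross term gives the wanted inequality after all.
re⊕ir : ∀ a b a′ b′ → 0ℚ ≤ a → five * (b * b) ≤ a * a → 0ℚ ≤ b′ → a′ * a′ ≤ five * (b′ * b′) →
  Cone ((a + a′) + (b + b′) √5)
re⊕ir a b a′ b′ 0≤a le 0≤b′ le′ with QP.≤-total 0ℚ (a + a′) | QP.≤-total 0ℚ (b + b′)
... | inj₁ 0≤s | inj₁ 0≤t = quadrant 0≤s 0≤t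
... | inj₁ 0≤s | inj₂ t≤0 = re-dominant 0≤s (bound (QP.≤-total (five * (t * t)) (s * s)))
  where
  s t : ℚ
  s = a + a′
  t = b + b′
  bound : five * (t * t) ≤ s * s ⊎ s * s ≤ five * (t * t) → five * (t * t) ≤ s * s
  bound (inj₁ le₁) = le₁
  bound (inj₂ le₂) = 0≤-⇒≤ (0≤-via
    (solveℚ 5 (λ a b a′ b′ f →
        (a ⊞ a′) ⊠ (a ⊞ a′) ⊟ f ⊠ ((b ⊞ b′) ⊠ (b ⊞ b′)) ≐
        ((a ⊠ a ⊟ f ⊠ (b ⊠ b)) ⊞ (f ⊠ (b′ ⊠ b′) ⊟ a′ ⊠ a′)) ⊞
        ((f ⊠ ((⊟ (b ⊞ b′)) ⊠ b′) ⊞ (a ⊞ a′) ⊠ a′) ⊞ (f ⊠ ((⊟ (b ⊞ b′)) ⊠ b′) ⊞ (a ⊞ a′) ⊠ a′)))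
      refl a b a′ b′ five)
    (0≤+ (0≤+ (≤⇒0≤- le) (≤⇒0≤- le′)) (0≤+ cross cross)))
    where
    cross : 0ℚ ≤ five * ((- t) * b′) + s * a′
    cross = cross-ir s (- t) a′ b′ (≤0⇒0≤- t≤0) 0≤b′
      (subst (s * s ≤_) (solveℚ 2 (λ f t → f ⊠ (t ⊠ t) ≐ f ⊠ ((⊟ t) ⊠ (⊟ t)))
          refl five t) le₂) le′
... | inj₂ s≤0 | inj₁ 0≤t = ir-dominant 0≤t (bound (QP.≤-total (five * (t * t)) (s * s)))
  where
  s t : ℚ
  s = a + a′
  t = b + b′
  bound : five * (t * t) ≤ s * s ⊎ s * s ≤ five * (t * t) → s * s ≤ five * (t * t)
  bound (inj₂ le₂) = le₂
  bound (inj₁ le₁) = 0≤-⇒≤ (0≤-via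
    (solveℚ 5 (λ a b a′ b′ f →
        f ⊠ ((b ⊞ b′) ⊠ (b ⊞ b′)) ⊟ (a ⊞ a′) ⊠ (a ⊞ a′) ≐
        ((a ⊠ a ⊟ f ⊠ (b ⊠ b)) ⊞ (f ⊠ (b′ ⊠ b′) ⊟ a′ ⊠ a′)) ⊞
        ((a ⊠ (⊟ (a ⊞ a′)) ⊞ f ⊠ (b ⊠ (b ⊞ b′))) ⊞ (a ⊠ (⊟ (a ⊞ a′)) ⊞ f ⊠ (b ⊠ (b ⊞ b′)))))
      refl a b a′ b′ five)
    (0≤+ (0≤+ (≤⇒0≤- le) (≤⇒0≤- le′)) (0≤+ cross cross)))
    where
    cross : 0ℚ ≤ a * (- s) + five * (b * t)
    cross = cross-re a b (- s) t 0≤a (≤0⇒0≤- s≤0) le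
      (subst (five * (t * t) ≤_) (solveℚ 1 (λ s → s ⊠ s ≐ (⊟ s) ⊠ (⊟ s)) refl s) le₁)
-- Here a ≤ -a′ and b′ ≤ -b chain with the two norm inequalities to a′² ≤ a² and b² ≤ b′², so both
-- sums are nonnegative after all.
... | inj₂ s≤0 | inj₂ t≤0 = quadrant
  (square-dominated 0≤a (begin
    a′ * a′                  ≤⟨ le′ ⟩
    five * (b′ * b′)         ≤⟨ *-mono-≤-0≤ 0≤five (0≤-square (- b)) QP.≤-refl b′²≤b² ⟩
    five * ((- b) * (- b))   ≡⟨ solveℚ 2 (λ f b → f ⊠ ((⊟ b) ⊠ (⊟ b)) ≐ f ⊠ (b ⊠ b))
        refl five b ⟩
    five * (b * b)           ≤⟨ le ⟩
    a * a                    ∎))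
  (0≤-via (QP.+-comm b b′) (square-dominated 0≤b′ (0≤-⇒≤ (five-cancel (0≤-via
    (solveℚ 3 (λ f b b′ → f ⊠ (b′ ⊠ b′ ⊟ b ⊠ b) ≐ f ⊠ (b′ ⊠ b′) ⊟ f ⊠ (b ⊠ b)) refl five b b′)
    (≤⇒0≤- (begin
      five * (b * b)        ≤⟨ le ⟩
      a * a                 ≤⟨ a²≤a′² ⟩
      (- a′) * (- a′)       ≡⟨ solveℚ 1 (λ a → (⊟ a) ⊠ (⊟ a) ≐ a ⊠ a) refl a′ ⟩
      a′ * a′               ≤⟨ le′ ⟩
      five * (b′ * b′)      ∎)))))))
  where
  open QP.≤-Reasoning
  b′≤-b : b′ ≤ - b
  b′≤-b = 0≤-⇒≤ (0≤-via (solveℚ 2 (λ b b′ → (⊟ b) ⊟ b′ ≐ ⊟ (b ⊞ b′)) refl b b′) (≤0⇒0≤- t≤0))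
  a≤-a′ : a ≤ - a′
  a≤-a′ = 0≤-⇒≤ (0≤-via (solveℚ 2 (λ a a′ → (⊟ a′) ⊟ a ≐ ⊟ (a ⊞ a′)) refl a a′) (≤0⇒0≤- s≤0))
  b′²≤b² : b′ * b′ ≤ (- b) * (- b)
  b′²≤b² = *-mono-≤-0≤ 0≤b′ (QP.≤-trans 0≤b′ b′≤-b) b′≤-b b′≤-b
  a²≤a′² : a * a ≤ (- a′) * (- a′)
  a²≤a′² = *-mono-≤-0≤ 0≤a (QP.≤-trans 0≤a a≤-a′) a≤-a′ a≤-a′

-- The norm of a sum is the sum of the norms plus twice a a′ - 5 b b′. Within one half, a cross
-- lemma with one sign flipped gives the sign of that term.
cone-+ : ∀ {x y} → Cone x → Cone y → Cone (x ⊕ y)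
cone-+ {a + b √5} {a′ + b′ √5} (re-dominant 0≤a le) (re-dominant 0≤a′ le′) =
  re-dominant (0≤+ 0≤a 0≤a′) (0≤-⇒≤ (0≤-via
    (solveℚ 5 (λ a b a′ b′ f →
        (a ⊞ a′) ⊠ (a ⊞ a′) ⊟ f ⊠ ((b ⊞ b′) ⊠ (b ⊞ b′)) ≐
        ((a ⊠ a ⊟ f ⊠ (b ⊠ b)) ⊞ (a′ ⊠ a′ ⊟ f ⊠ (b′ ⊠ b′))) ⊞
        ((a ⊠ a′ ⊞ f ⊠ (b ⊠ (⊟ b′))) ⊞ (a ⊠ a′ ⊞ f ⊠ (b ⊠ (⊟ b′)))))
      refl a b a′ b′ five)
    (0≤+ (0≤+ (≤⇒0≤- le) (≤⇒0≤- le′)) (0≤+ cross cross))))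
  where
  cross : 0ℚ ≤ a * a′ + five * (b * (- b′))
  cross = cross-re a b a′ (- b′) 0≤a 0≤a′ le
    (subst (_≤ a′ * a′) (solveℚ 2 (λ f b → f ⊠ (b ⊠ b) ≐ f ⊠ ((⊟ b) ⊠ (⊟ b))) refl five b′) le′)
cone-+ {a + b √5} {a′ + b′ √5} (ir-dominant 0≤b le) (ir-dominant 0≤b′ le′) =
  ir-dominant (0≤+ 0≤b 0≤b′) (0≤-⇒≤ (0≤-via
    (solveℚ 5 (λ a b a′ b′ f →
        f ⊠ ((b ⊞ b′) ⊠ (b ⊞ b′)) ⊟ (a ⊞ a′) ⊠ (a ⊞ a′) ≐
        ((f ⊠ (b ⊠ b) ⊟ a ⊠ a) ⊞ (f ⊠ (b′ ⊠ b′) ⊟ a′ ⊠ a′)) ⊞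
        ((f ⊠ (b ⊠ b′) ⊞ a ⊠ (⊟ a′)) ⊞ (f ⊠ (b ⊠ b′) ⊞ a ⊠ (⊟ a′))))
      refl a b a′ b′ five)
    (0≤+ (0≤+ (≤⇒0≤- le) (≤⇒0≤- le′)) (0≤+ cross cross))))
  where
  cross : 0ℚ ≤ five * (b * b′) + a * (- a′)
  cross = cross-ir a b (- a′) b′ 0≤b 0≤b′ le
    (subst (_≤ five * (b′ * b′)) (solveℚ 1 (λ a → a ⊠ a ≐ (⊟ a) ⊠ (⊟ a)) refl a′) le′)
cone-+ {a + b √5} {a′ + b′ √5} (re-dominant 0≤a le) (ir-dominant 0≤b′ le′) =
  re⊕ir a b a′ b′ 0≤a le 0≤b′ le′
cone-+ {a + b √5} {a′ + b′ √5} (ir-dominant 0≤b le) (re-dominant 0≤a′ le′) =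
  subst Cone (cong₂ _+_√5 (QP.+-comm a′ a) (QP.+-comm b′ b)) (re⊕ir a′ b′ a b 0≤a′ le′ 0≤b le)

-- Commutative ring structure and ring solver

≡-ext : ∀ {a a′ b b′} → a ≡ a′ → b ≡ b′ → (a + b √5) ≡ (a′ + b′ √5)
≡-ext = cong₂ _+_√5

⊕-assoc : Associative _⊕_
⊕-assoc x y z = ≡-ext (QP.+-assoc (re x) (re y) (re z)) (QP.+-assoc (ir x) (ir y) (ir z))

⊕-comm : Commutative _⊕_
⊕-comm x y = ≡-ext (QP.+-comm (re x) (re y)) (QP.+-comm (ir x) (ir y))

⊕-identityˡ : LeftIdentity zero√5 _⊕_
⊕-identityˡ x = ≡-ext (QP.+-identityˡ (re x)) (QP.+-identityˡ (ir x))

⊕-identityʳ : RightIdentity zero√5 _⊕_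
⊕-identityʳ x = ≡-ext (QP.+-identityʳ (re x)) (QP.+-identityʳ (ir x))

⊝-inverseˡ : LeftInverse zero√5 ⊝_ _⊕_
⊝-inverseˡ x = ≡-ext (QP.+-inverseˡ (re x)) (QP.+-inverseˡ (ir x))

⊝-inverseʳ : RightInverse zero√5 ⊝_ _⊕_
⊝-inverseʳ x = ≡-ext (QP.+-inverseʳ (re x)) (QP.+-inverseʳ (ir x))

⊛-comm : Commutative _⊛_
⊛-comm (a + b √5) (a′ + b′ √5) = ≡-ext
  (solveℚ 5 (λ a b a′ b′ f → a ⊠ a′ ⊞ f ⊠ (b ⊠ b′) ≐ a′ ⊠ a ⊞ f ⊠ (b′ ⊠ b)) refl a b a′ b′ five)
  (solveℚ 4 (λ a b a′ b′ → a ⊠ b′ ⊞ b ⊠ a′ ≐ a′ ⊠ b ⊞ b′ ⊠ a) refl a b a′ b′)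

⊛-assoc : Associative _⊛_
⊛-assoc (a + b √5) (a′ + b′ √5) (a″ + b″ √5) = ≡-ext
  (solveℚ 7 (λ a b a′ b′ a″ b″ f →
     (a ⊠ a′ ⊞ f ⊠ (b ⊠ b′)) ⊠ a″ ⊞ f ⊠ ((a ⊠ b′ ⊞ b ⊠ a′) ⊠ b″) ≐
     a ⊠ (a′ ⊠ a″ ⊞ f ⊠ (b′ ⊠ b″)) ⊞ f ⊠ (b ⊠ (a′ ⊠ b″ ⊞ b′ ⊠ a″))) refl a b a′ b′ a″ b″ five)
  (solveℚ 7 (λ a b a′ b′ a″ b″ f →
     (a ⊠ a′ ⊞ f ⊠ (b ⊠ b′)) ⊠ b″ ⊞ (a ⊠ b′ ⊞ b ⊠ a′) ⊠ a″ ≐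
     a ⊠ (a′ ⊠ b″ ⊞ b′ ⊠ a″) ⊞ b ⊠ (a′ ⊠ a″ ⊞ f ⊠ (b′ ⊠ b″))) refl a b a′ b′ a″ b″ five)

⊛-identityˡ : LeftIdentity one√5 _⊛_
⊛-identityˡ (a + b √5) = ≡-ext
  (solveℚ 3 (λ a b f → κ 1ℚ ⊠ a ⊞ f ⊠ (κ 0ℚ ⊠ b) ≐ a) refl a b five)
  (solveℚ 2 (λ a b → κ 1ℚ ⊠ b ⊞ κ 0ℚ ⊠ a ≐ b) refl a b)

⊛-identityʳ : RightIdentity one√5 _⊛_
⊛-identityʳ x = trans (⊛-comm x one√5) (⊛-identityˡ x)

⊛-distribˡ-⊕ : _⊛_ DistributesOverˡ _⊕_
⊛-distribˡ-⊕ (a + b √5) (a′ + b′ √5) (a″ + b″ √5) = ≡-ext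
  (solveℚ 7 (λ a b a′ b′ a″ b″ f →
     a ⊠ (a′ ⊞ a″) ⊞ f ⊠ (b ⊠ (b′ ⊞ b″)) ≐
     (a ⊠ a′ ⊞ f ⊠ (b ⊠ b′)) ⊞ (a ⊠ a″ ⊞ f ⊠ (b ⊠ b″))) refl a b a′ b′ a″ b″ five)
  (solveℚ 6 (λ a b a′ b′ a″ b″ →
     a ⊠ (b′ ⊞ b″) ⊞ b ⊠ (a′ ⊞ a″) ≐
     (a ⊠ b′ ⊞ b ⊠ a′) ⊞ (a ⊠ b″ ⊞ b ⊠ a″)) refl a b a′ b′ a″ b″)

⊛-distribʳ-⊕ : _⊛_ DistributesOverʳ _⊕_
⊛-distribʳ-⊕ x y z = trans (⊛-comm (y ⊕ z) x)
  (trans (⊛-distribˡ-⊕ x y z) (cong₂ _⊕_ (⊛-comm x y) (⊛-comm x z)))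

⊕-⊛-commutativeRing : CommutativeRing _ _
⊕-⊛-commutativeRing = record
  { Carrier = ℚ√5 ; _≈_ = _≡_ ; _+_ = _⊕_ ; _*_ = _⊛_ ; -_ = ⊝_ ; 0# = zero√5 ; 1# = one√5
  ; isCommutativeRing = record
    { isRing = record
      { +-isAbelianGroup = record
        { isGroup = record
          { isMonoid = record
            { isSemigroup = record
              { isMagma = record { isEquivalence = isEquivalence ; ∙-cong = cong₂ _⊕_ }
              ; assoc = ⊕-assoc }
            ; identity = ⊕-identityˡ , ⊕-identityʳ }
          ; inverse = ⊝-inverseˡ , ⊝-inverseʳ
          ; ⁻¹-cong = cong ⊝_ }
        ; comm = ⊕-comm }
      ; *-cong = cong₂ _⊛_
      ; *-assoc = ⊛-assoc
      ; *-identity = ⊛-identityˡ , ⊛-identityʳ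
      ; distrib = ⊛-distribˡ-⊕ , ⊛-distribʳ-⊕ }
    ; *-comm = ⊛-comm } }

_≟√5_ : DecidableEquality ℚ√5
(a + b √5) ≟√5 (a′ + b′ √5) = map′ (λ (p , q) → ≡-ext p q) (λ eq → cong re eq , cong ir eq)
  ((a QP.≟ a′) ×-dec (b QP.≟ b′))

module ℚ√5-Solver = RingSolver (ACR.fromCommutativeRing ⊕-⊛-commutativeRing) _≟√5_
open ℚ√5-Solver using (Polynomial; solve; _:=_; _:+_; _:*_; _:-_; :-_; con)

-- Certificates for inequalities, and the positive part

nonNeg? : ∀ x → Dec (NonNeg x)
nonNeg? (a + b √5) =
  (0ℚ QP.≤? a ×-dec 0ℚ QP.≤? b) ⊎-dec
  (0ℚ QP.≤? a ×-dec b QP.≤? 0ℚ ×-dec five * (b * b) QP.≤? a * a) ⊎-dec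
  (a QP.≤? 0ℚ ×-dec 0ℚ QP.≤? b ×-dec a * a QP.≤? five * (b * b))

infixl 6 _+ⁿ_
infixl 7 _*ⁿ_
infix 5 _because_

_+ⁿ_ : ∀ {x y} → NonNeg x → NonNeg y → NonNeg (x ⊕ y)
p +ⁿ q = fromCone (cone-+ (toCone p) (toCone q))

_*ⁿ_ : ∀ {x y} → NonNeg x → NonNeg y → NonNeg (x ⊛ y)
p *ⁿ q = fromCone (cone-* (toCone p) (toCone q))

closed : ∀ x {_ : True (nonNeg? x)} → NonNeg x
closed x {t} = toWitness t

-- The inequalities below are certified in the style of Farkas: a difference is a combination of
-- known nonnegative terms with nonnegative constants, `because` of a ring identity.
_because_ : ∀ {x y} → NonNeg y → x ≡ y → NonNeg x
p because eq = subst NonNeg (sym eq) p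

≼-refl : ∀ x → x ≼ x
≼-refl x = closed zero√5 because ⊝-inverseʳ x

≼-trans : ∀ x y z → x ≼ y → y ≼ z → x ≼ z
≼-trans x y z x≼y y≼z = (x≼y +ⁿ y≼z) because
  solve 3 (λ x y z → z :- x := (y :- x) :+ (z :- y)) refl x y z

⊕-mono-≼ : ∀ w x y z → w ≼ x → y ≼ z → w ⊕ y ≼ x ⊕ z
⊕-mono-≼ w x y z w≼x y≼z = (w≼x +ⁿ y≼z) because
  solve 4 (λ w x y z → x :+ z :- (w :+ y) := (x :- w) :+ (z :- y)) refl w x y z

posPart : ℚ√5 → ℚ√5
posPart x with cone-total x
... | inj₁ _ = x
... | inj₂ _ = zero√5

posPart-nonNeg : ∀ x → NonNeg (posPart x)
posPart-nonNeg x with cone-total x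
... | inj₁ 0≤x = fromCone 0≤x
... | inj₂ _   = closed zero√5

posPart-upper : ∀ x → x ≼ posPart x
posPart-upper x with cone-total x
... | inj₁ _   = closed zero√5 because solve 1 (λ x → x :- x := con zero√5) refl x
... | inj₂ x≤0 = fromCone x≤0 because solve 1 (λ x → con zero√5 :- x := :- x) refl x

-- Upper bounds on shares go through this lemma, which avoids deciding the sign of x in each of
-- them.
posPart-least : ∀ x {w} → NonNeg w → x ≼ w → posPart x ≼ w
posPart-least x {w} 0≤w x≤w with cone-total x
... | inj₁ _ = x≤w
... | inj₂ _ = 0≤w because solve 1 (λ w → w :- con zero√5 := w) refl w

-- Shares of a single edge

-- h = c/2 and ψ = 1/φ.
h ψ ½ : ℚ√5
h = (+ 9 / 38) + (+ 1 / 38) √5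
ψ = (-[1+ 0 ] / 2) + (+ 1 / 2) √5
½ = (+ 1 / 2) + 0ℚ √5

-- α = 1 - c - h is the least value of the forced 1 - c - z when z ≤ h. Since α + β = c, an exact
-- split of c with one part in [α , β] has the other part there too.
α β : ℚ√5
α = one√5 ⊖ h ⊖ h ⊖ h
β = c ⊖ α

-- The fixed point of (x , z) ↦ (1 - c - z , 2c - 1 - x + z).
x⋆ z⋆ : ℚ√5
x⋆ = c ⊕ c ⊖ one√5
z⋆ = one√5 ⊕ one√5 ⊖ c ⊖ c ⊖ c

-- Nonnegative below the stable line through the fixed point; the map multiplies it by φ.
slack : ℚ√5 → ℚ√5 → ℚ√5
slack x z = ψ ⊛ (x ⊖ x⋆) ⊖ (z ⊖ z⋆)

:slack : ∀ {n} → Polynomial n → Polynomial n → Polynomial n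
:slack x z = con ψ :* (x :- con x⋆) :- (z :- con z⋆)

DualRange : ℚ√5 → Set
DualRange x = α ≼ x × x ≼ β

-- At degree one, z ≤ h leaves room α below 1 - c, and `slack` keeps the next forced state feasible.
-- At degree two one edge remains: a fresh neighbour makes it worth c - x, which brings the load to
-- c + z.
Safe₁ Safe₂ : ℚ√5 → ℚ√5 → Set
Safe₁ x z = DualRange x × NonNeg z × z ≼ h × NonNeg (slack x z)
Safe₂ x z = DualRange x × z ≼ one√5 ⊖ c

data Vertex : Set where
  fresh : Vertex
  one two full : ℚ√5 → ℚ√5 → Vertex

-- The constructors record the degree; rest is the part of the load credited to neighbours.
dual rest : Vertex → ℚ√5
dual fresh = zero√5
dual (one x _) = x
dual (two x _) = x
dual (full x _) = x
rest fresh = zero√5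
rest (one _ z) = z
rest (two _ z) = z
rest (full _ z) = z

-- p is the vertex's own share of the new edge, q the share of the other endpoint. The last clause
-- is a default for vertices that receive no further edge.
grow : Vertex → ℚ√5 → ℚ√5 → Vertex
grow fresh p q = one p q
grow (one x z) p q = two (x ⊕ p) (z ⊕ q)
grow (two x z) p q = full (x ⊕ p) (z ⊕ q)
grow (full x z) p q = full (x ⊕ p) (z ⊕ q)

Safe : Vertex → Set
Safe fresh = ⊤
Safe (one x z) = Safe₁ x z
Safe (two x z) = Safe₂ x z
Safe (full x z) = x ⊕ z ≼ one√5

-- Against a fresh vertex, a vertex of degree one takes just enough dual value to
-- keep its rest at most 1 - c; the last clause is junk, as a full vertex receives no further edge.
share : Vertex → Vertex → ℚ√5 × ℚ√5
share fresh fresh = h , h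
share fresh (one x z) = let q = posPart (z ⊕ x⋆ ⊖ x) in c ⊖ x ⊖ q , q
share fresh (two x z) = c ⊖ x , zero√5
share (one x z) (one x′ z′) = let y = ½ ⊛ posPart (c ⊖ x ⊖ x′) in y , y
share (one x z) (two x′ z′) = posPart (c ⊖ x ⊖ x′) , zero√5
share (two x z) (two x′ z′) = posPart (c ⊖ x ⊖ x′) , zero√5
share (one x z) fresh = swap (share fresh (one x z))
share (two x z) fresh = swap (share fresh (two x z))
share (two x z) (one x′ z′) = swap (share (one x′ z′) (two x z))
share _ _ = zero√5 , zero√5

-- Soundness of the shares, by the degrees of the endpoints

record Sound (U V : Vertex) (p q : ℚ√5) : Set where
  constructor sound
  field
    0≤p : NonNeg p
    0≤q : NonNeg q
    covered : c ≼ (dual U ⊕ p) ⊕ (dual V ⊕ q)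
    safeˡ : Safe (grow U p q)
    safeʳ : Safe (grow V q p)

Sound-swap : ∀ {U V p q} → Sound U V p q → Sound V U q p
Sound-swap {U} {V} {p} {q} (sound 0≤p 0≤q cov sU sV) =
  sound 0≤q 0≤p (subst (c ≼_) (⊕-comm (dual U ⊕ p) (dual V ⊕ q)) cov) sV sU

fresh-fresh : Sound fresh fresh h h
fresh-fresh = sound (closed h) (closed h) (closed _) s s
  where
  s : Safe₁ h h
  -- The last component is tight: `slack h h` is zero, so the first edge starts on the boundary
  -- line.
  s = (closed _ , closed _) , closed _ , closed _ , closed _

-- slack (c - x - q) q is decreasing in q and vanishes at q = maxRest x.
maxRest : ℚ√5 → ℚ√5
maxRest x = ψ ⊛ (ψ ⊛ (c ⊖ x ⊖ x⋆) ⊕ z⋆)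

:maxRest : ∀ {n} → Polynomial n → Polynomial n
:maxRest x = con ψ :* (con ψ :* (con c :- x :- con x⋆) :+ con z⋆)

-- `maxRest` decreases in x and still equals α at the end x = β of the range.
maxRest-nonNeg : ∀ x → DualRange x → NonNeg (maxRest x)
maxRest-nonNeg x (_ , x≼β) = (closed (ψ ⊛ ψ) *ⁿ x≼β +ⁿ closed α) because
  solve 1 (λ x → :maxRest x := con (ψ ⊛ ψ) :* (con β :- x) :+ con α) refl x

slack-maxRest : ∀ x {q} → q ≼ maxRest x → NonNeg (slack (c ⊖ x ⊖ q) q)
slack-maxRest x {q} q≼ = (closed (one√5 ⊕ ψ) *ⁿ q≼) because
  solve 2 (λ x q → :slack (con c :- x :- q) q := con (one√5 ⊕ ψ) :* (:maxRest x :- q)) refl x q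

-- If q is positive, the new vertex gets the forced state (1 - c - z , q) and the old one ends with
-- rest exactly 1 - c; if q is zero, the new vertex takes all of c - x.
fresh-one : ∀ x z → Safe₁ x z → let q = posPart (z ⊕ x⋆ ⊖ x) in Sound fresh (one x z) (c ⊖ x ⊖ q) q
fresh-one x z (range@(lower , upper) , _ , z≼h , slack≥0) = sound 0≤p 0≤q
  (closed zero√5 because solve 2 (λ x q → (con zero√5 :+ (con c :- x :- q)) :+ (x :+ q) :- con c := con zero√5) refl x q)
  (((q≼β-x because solve 2 (λ x q → con c :- x :- q :- con α := con β :- x :- q) refl x q) ,
      ((lower +ⁿ 0≤q) because solve 2 (λ x q → con β :- (con c :- x :- q) := x :- con α :+ q)
          refl x q)) ,
    0≤q , q≼h , (slack-maxRest x q≼maxRest))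
  ((((lower +ⁿ 0≤q) because solve 2 (λ x q → x :+ q :- con α := x :- con α :+ q) refl x q) ,
      (q≼β-x because solve 2 (λ x q → con β :- (x :+ q) := con β :- x :- q) refl x q)) ,
    (posPart-upper t because solve 3 (λ x z q → con one√5 :- con c :- (z :+ (con c :- x :- q)) :=
        q :- (z :+ con x⋆ :- x)) refl x z q))
  where
  t q : ℚ√5
  t = z ⊕ x⋆ ⊖ x
  q = posPart t
  0≤q : NonNeg q
  0≤q = posPart-nonNeg t
  -- This gives both x + q ≤ β at the old vertex and p ≥ α at the new one; the gap in the nontrivial
  -- case is h - z.
  q≼β-x : q ≼ β ⊖ x
  q≼β-x = posPart-least t upper
    (z≼h because solve 2 (λ x z → con β :- x :- (z :+ con x⋆ :- x) := con h :- z) refl x z)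
  0≤p : NonNeg (c ⊖ x ⊖ q)
  0≤p = (q≼β-x +ⁿ closed α) because solve 2 (λ x q → con c :- x :- q := con β :- x :- q :+ con α)
      refl x q
  q≼h : q ≼ h
  q≼h = posPart-least t (closed h)
    ((slack≥0 +ⁿ closed (one√5 ⊖ ψ) *ⁿ lower +ⁿ closed (z⋆ ⊖ x⋆)) because
      solve 2 (λ x z → con h :- (z :+ con x⋆ :- x) :=
        :slack x z :+ con (one√5 ⊖ ψ) :* (x :- con α) :+ con (z⋆ ⊖ x⋆)) refl x z)
  -- The invariance of the half-plane: the forced q falls short of `maxRest x` by exactly
  -- `slack x z`.
  q≼maxRest : q ≼ maxRest x
  q≼maxRest = posPart-least t (maxRest-nonNeg x range)
    (slack≥0 because solve 2 (λ x z → :maxRest x :- (z :+ con x⋆ :- x) := :slack x z) refl x z)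

range-nonNeg : ∀ x → DualRange x → NonNeg x
range-nonNeg x (lower , _) = (lower +ⁿ closed α) because solve 1 (λ x → x := x :- con α :+ con α)
    refl x

fresh-two : ∀ x z → Safe₂ x z → Sound fresh (two x z) (c ⊖ x) zero√5
fresh-two x z (range@(lower , upper) , room) = sound
  ((upper +ⁿ closed α) because solve 1 (λ x → con c :- x := con β :- x :+ con α) refl x)
  (closed zero√5)
  (closed zero√5 because solve 1 (λ x → (con zero√5 :+ (con c :- x)) :+ (x :+ con zero√5) :- con c := con zero√5) refl x)
  (((upper because solve 1 (λ x → con c :- x :- con α := con β :- x) refl x) ,
      (lower because solve 1 (λ x → con β :- (con c :- x) := x :- con α) refl x)) ,
    (closed zero√5) , (closed h) ,
    (subst (λ p → NonNeg (slack p zero√5)) (solve 1 (λ x → con c :- x :- con zero√5 :=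
        con c :- x) refl x)
      (slack-maxRest x {zero√5} (maxRest-nonNeg x range because ⊕-identityʳ (maxRest x)))))
  (room because solve 2 (λ x z → con one√5 :- ((x :+ con zero√5) :+ (z :+ (con c :- x))) :=
      con one√5 :- con c :- z) refl x z)

gap-covered : ∀ x x′ → c ≼ (x ⊕ posPart (c ⊖ x ⊖ x′)) ⊕ (x′ ⊕ zero√5)
gap-covered x x′ = posPart-upper (c ⊖ x ⊖ x′) because
  solve 3 (λ x x′ y → (x :+ y) :+ (x′ :+ con zero√5) :- con c := y :- (con c :- x :- x′))
      refl x x′ (posPart (c ⊖ x ⊖ x′))

-- If the gap is positive, filling it lifts the load of the vertex (x′ , z) to c - x + z, at most 1
-- since z ≤ 1 - c and x ≥ 0.
gap≼room : ∀ x x′ z → DualRange x → Safe₂ x′ z → posPart (c ⊖ x ⊖ x′) ≼ one√5 ⊖ x′ ⊖ z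
gap≼room x x′ z r ((_ , upper) , room) = posPart-least (c ⊖ x ⊖ x′)
  ((upper +ⁿ room +ⁿ closed α) because
    solve 2 (λ x z → con one√5 :- x :- z := (con β :- x) :+ (con one√5 :- con c :- z) :+ con α)
        refl x′ z)
  ((room +ⁿ range-nonNeg x r) because
    solve 3 (λ x x′ z → con one√5 :- x′ :- z :- (con c :- x :- x′) :=
        (con one√5 :- con c :- z) :+ x) refl x x′ z)

gap≼β : ∀ x x′ → DualRange x → DualRange x′ → posPart (c ⊖ x ⊖ x′) ≼ β ⊖ x
gap≼β x x′ (_ , upper) (lower′ , _) = posPart-least (c ⊖ x ⊖ x′) upper
  (lower′ because solve 2 (λ x x′ → con β :- x :- (con c :- x :- x′) := x′ :- con α) refl x x′)

-- Each endpoint's share adds to the other's rest, and both must end with rest at most 1 - c;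
-- halving the gap splits this burden evenly.
one-one : ∀ x z x′ z′ → Safe₁ x z → Safe₁ x′ z′ →
  let y = ½ ⊛ posPart (c ⊖ x ⊖ x′) in Sound (one x z) (one x′ z′) y y
one-one x z x′ z′ s s′ = sound 0≤y 0≤y
  (posPart-upper g because
      solve 3 (λ x x′ y → (x :+ con ½ :* y) :+ (x′ :+ con ½ :* y) :- con c :=
          y :- (con c :- x :- x′)) refl x x′ (posPart g))
  (half-safe x z x′ z′ s s′)
  (subst (λ g → Safe₂ (x′ ⊕ ½ ⊛ posPart g) (z′ ⊕ ½ ⊛ posPart g))
    (solve 2 (λ x x′ → con c :- x′ :- x := con c :- x :- x′)
        refl x x′) (half-safe x′ z′ x z s′ s))
  where
  g : ℚ√5
  g = c ⊖ x ⊖ x′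
  0≤y : NonNeg (½ ⊛ posPart g)
  0≤y = closed ½ *ⁿ posPart-nonNeg g
  half-safe : ∀ x z x′ z′ → Safe₁ x z → Safe₁ x′ z′ →
    let y = ½ ⊛ posPart (c ⊖ x ⊖ x′) in Safe₂ (x ⊕ y) (z ⊕ y)
  half-safe x z x′ z′ (range@(lower , upper) , _ , z≼h , slack≥0) (range′@(lower′ , _) , _) =
      (((lower +ⁿ closed ½ *ⁿ 0≤Y) because
        solve 2 (λ x y → x :+ con ½ :* y :- con α := x :- con α :+ con ½ :* y) refl x Y) ,
      ((closed ½ *ⁿ (gap≼β x x′ range range′ +ⁿ upper)) because
        solve 2 (λ x y → con β :- (x :+ con ½ :* y) :=
            con ½ :* ((con β :- x :- y) :+ (con β :- x))) refl x Y)) ,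
    ((closed ½ *ⁿ Y≼2room) because
      solve 2 (λ z y → con one√5 :- con c :- (z :+ con ½ :* y) :=
        con ½ :* ((con one√5 :- con c :- z) :+ (con one√5 :- con c :- z) :- y)) refl z Y)
    where
    Y : ℚ√5
    Y = posPart (c ⊖ x ⊖ x′)
    0≤Y : NonNeg Y
    0≤Y = posPart-nonNeg (c ⊖ x ⊖ x′)
    0≤room : NonNeg (one√5 ⊖ c ⊖ z)
    0≤room = (z≼h +ⁿ closed α) because
      solve 1 (λ z → con one√5 :- con c :- z := con h :- z :+ con α) refl z
    Y≼2room : Y ≼ (one√5 ⊖ c ⊖ z) ⊕ (one√5 ⊖ c ⊖ z)
    Y≼2room = posPart-least (c ⊖ x ⊖ x′) (0≤room +ⁿ 0≤room)
      -- The weight 1 + ψ = 1/ψ on `slack` gives x the coefficient 1, and 1 - ψ on h - z completes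
      -- the coefficient of z to -2.
      ((lower′ +ⁿ closed (one√5 ⊕ ψ) *ⁿ slack≥0
        +ⁿ closed (one√5 ⊖ ψ) *ⁿ z≼h +ⁿ closed (z⋆ ⊖ x⋆)) because
        solve 3 (λ x z x′ → (con one√5 :- con c :- z) :+ (con one√5 :- con c :- z) :- (con c :- x :- x′) :=
          (x′ :- con α) :+ con (one√5 ⊕ ψ) :* :slack x z :+ con (one√5 ⊖ ψ) :* (con h :- z) :+ con (z⋆ ⊖ x⋆)) refl x z x′)

-- The endpoint of degree one takes the whole gap, so its rest does not grow; the other endpoint
-- becomes full and only its load matters.
one-two : ∀ x z x′ z′ → Safe₁ x z → Safe₂ x′ z′ →
  Sound (one x z) (two x′ z′) (posPart (c ⊖ x ⊖ x′)) zero√5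
one-two x z x′ z′ (range@(lower , _) , _ , z≼h , _) s′@(range′ , _) =
    sound 0≤Y (closed zero√5) (gap-covered x x′)
  ((((lower +ⁿ 0≤Y) because solve 2 (λ x y → x :+ y :- con α := x :- con α :+ y) refl x Y) ,
      (gap≼β x x′ range range′ because solve 2 (λ x y → con β :- (x :+ y) := con β :- x :- y)
          refl x Y)) ,
    ((z≼h +ⁿ closed α) because solve 1 (λ z → con one√5 :- con c :- (z :+ con zero√5) :=
        con h :- z :+ con α) refl z))
  (gap≼room x x′ z′ range s′ because
     solve 3 (λ x z y → con one√5 :- ((x :+ con zero√5) :+ (z :+ y)) := con one√5 :- x :- z :- y)
         refl x′ z′ Y)
  where
  Y : ℚ√5
  Y = posPart (c ⊖ x ⊖ x′)
  0≤Y : NonNeg Y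
  0≤Y = posPart-nonNeg (c ⊖ x ⊖ x′)

two-two : ∀ x z x′ z′ → Safe₂ x z → Safe₂ x′ z′ →
  Sound (two x z) (two x′ z′) (posPart (c ⊖ x ⊖ x′)) zero√5
two-two x z x′ z′ s@(range , _) s′@(range′ , _) = sound 0≤Y (closed zero√5) (gap-covered x x′)
  (gap≼room x′ x z range′ s because trans
     (solve 3 (λ x z y → con one√5 :- ((x :+ y) :+ (z :+ con zero√5)) :=
         con one√5 :- x :- z :- y) refl x z Y)
     (cong (λ g → one√5 ⊖ x ⊖ z ⊖ posPart g) (solve 2 (λ x x′ → con c :- x :- x′ :=
         con c :- x′ :- x) refl x x′)))
  (gap≼room x x′ z′ range s′ because
     solve 3 (λ x z y → con one√5 :- ((x :+ con zero√5) :+ (z :+ y)) := con one√5 :- x :- z :- y)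
         refl x′ z′ Y)
  where
  Y : ℚ√5
  Y = posPart (c ⊖ x ⊖ x′)
  0≤Y : NonNeg Y
  0≤Y = posPart-nonNeg (c ⊖ x ⊖ x′)

rank : Vertex → ℕ
rank fresh = 0
rank (one _ _) = 1
rank (two _ _) = 2
rank (full _ _) = 3

rank-grow : ∀ U p q → rank U ℕ.≤ 2 → rank (grow U p q) ≡ suc (rank U)
rank-grow fresh p q _ = refl
rank-grow (one _ _) p q _ = refl
rank-grow (two _ _) p q _ = refl
rank-grow (full _ _) p q (s≤s (s≤s ()))

share-sound : ∀ U V → rank U ℕ.≤ 2 → rank V ℕ.≤ 2 → Safe U → Safe V →
  Sound U V (proj₁ (share U V)) (proj₂ (share U V))
share-sound fresh fresh _ _ _ _ = fresh-fresh
share-sound fresh (one x z) _ _ _ s = fresh-one x z s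
share-sound fresh (two x z) _ _ _ s = fresh-two x z s
share-sound (one x z) fresh _ _ s _ = Sound-swap (fresh-one x z s)
share-sound (one x z) (one x′ z′) _ _ s s′ = one-one x z x′ z′ s s′
share-sound (one x z) (two x′ z′) _ _ s s′ = one-two x z x′ z′ s s′
share-sound (two x z) fresh _ _ s _ = Sound-swap (fresh-two x z s)
share-sound (two x z) (one x′ z′) _ _ s s′ = Sound-swap (one-two x′ z′ x z s′ s)
share-sound (two x z) (two x′ z′) _ _ s s′ = two-two x z x′ z′ s s′
share-sound (full _ _) _ (s≤s (s≤s ()))
share-sound _ (full _ _) _ (s≤s (s≤s ()))

dual-grow : ∀ U p q → dual (grow U p q) ≡ dual U ⊕ p
dual-grow fresh p q = sym (⊕-identityˡ p)
dual-grow (one _ _) p q = refl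
dual-grow (two _ _) p q = refl
dual-grow (full _ _) p q = refl

rest-grow : ∀ U p q → rest (grow U p q) ≡ rest U ⊕ q
rest-grow fresh p q = sym (⊕-identityˡ q)
rest-grow (one _ _) p q = refl
rest-grow (two _ _) p q = refl
rest-grow (full _ _) p q = refl

safe-load : ∀ U → Safe U → dual U ⊕ rest U ≼ one√5
safe-load fresh _ = closed one√5
safe-load (one x z) ((_ , upper) , _ , z≼h , _) = (upper +ⁿ z≼h +ⁿ closed z⋆) because
  solve 2 (λ x z → con one√5 :- (x :+ z) := (con β :- x) :+ (con h :- z) :+ con z⋆) refl x z
safe-load (two x z) ((_ , upper) , room) = (upper +ⁿ room +ⁿ closed α) because
  solve 2 (λ x z → con one√5 :- (x :+ z) := (con β :- x) :+ (con one√5 :- con c :- z) :+ con α)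
      refl x z
safe-load (full x z) load≼1 = load≼1

-- Runs of an online algorithm

Trace : Set
Trace = List (Edge × ℚ√5)

-- The loop of run is local to Defs; unification with a goal in which its history
-- argument has been generalised recovers it.
mutual
  replay : OnlineAlg → List Edge → List Edge → Trace
  replay = _

  run-replay : ∀ alg e es → drop 1 (run alg (e ∷ es)) ≡ replay alg [ e ] es
  run-replay alg e es with [ e ]
  ... | h = refl

-- Agreement is assumed on all extensions of the two histories because the loop appends arrivals at
-- the end; reassociating renews the assumption.
replay-cong : ∀ alg alg′ h h′ → (∀ k e → alg (h ++ k) e ≡ alg′ (h′ ++ k) e) →
  ∀ es → replay alg h es ≡ replay alg′ h′ es
replay-cong alg alg′ h h′ eq [] = refl
replay-cong alg alg′ h h′ eq (e ∷ es) =
  cong₂ _∷_ (cong (e ,_) now) (replay-cong alg alg′ (h ++ [ e ]) (h′ ++ [ e ]) later es)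
  where
  now : alg h e ≡ alg′ h′ e
  now = subst₂ (λ l l′ → alg l e ≡ alg′ l′ e) (++-identityʳ h) (++-identityʳ h′) (eq [] e)
  later : ∀ k f → alg ((h ++ [ e ]) ++ k) f ≡ alg′ ((h′ ++ [ e ]) ++ k) f
  later k f = subst₂ (λ l l′ → alg l f ≡ alg′ l′ f)
    (sym (++-assoc h [ e ] k)) (sym (++-assoc h′ [ e ] k)) (eq (e ∷ k) f)

shift : Edge → OnlineAlg → OnlineAlg
shift e alg h = alg (e ∷ h)

-- Trades the history accumulator for a changed algorithm, so that later inductions speak of `run`
-- alone.
run-∷ : ∀ alg e es → run alg (e ∷ es) ≡ (e , alg [] e) ∷ run (shift e alg) es
run-∷ alg e es = cong ((e , alg [] e) ∷_) (replay-cong alg (shift e alg) [ e ] [] (λ _ _ → refl) es)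

-- Causality: the first t values depend on the first t edges only, so the guarantee at time t
-- concerns a complete run on a prefix.
run-take : ∀ alg es t → take t (run alg es) ≡ run alg (take t es)
run-take alg es zero = refl
run-take alg [] (suc t) = refl
run-take alg (e ∷ es) (suc t) = begin
  take (suc t) (run alg (e ∷ es))                       ≡⟨ cong (take (suc t)) (run-∷ alg e es) ⟩
  (e , alg [] e) ∷ take t (run (shift e alg) es)        ≡⟨ cong ((e , alg [] e) ∷_) (run-take (shift e alg) es t) ⟩
  (e , alg [] e) ∷ run (shift e alg) (take t es)        ≡⟨ run-∷ alg e (take t es) ⟨
  run alg (e ∷ take t es)                               ∎
  where open ≡-Reasoning

-- The global invariant

State : Set
State = ℕ → Vertex

set : ℕ → Vertex → State → State
set u U s w with w ℕ.≟ u
... | yes _ = U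
... | no _  = s w

shareˡ shareʳ value : State → Edge → ℚ√5
shareˡ s (u , v) = proj₁ (share (s u) (s v))
shareʳ s (u , v) = proj₂ (share (s u) (s v))
value s e = shareˡ s e ⊕ shareʳ s e

step : State → Edge → State
step s e@(u , v) = set u (grow (s u) (shareˡ s e) (shareʳ s e)) (set v (grow (s v) (shareʳ s e) (shareˡ s e)) s)

-- The state is recomputed from the history. With the start state as a parameter,
-- `shift e (online s)` is definitionally `online (step s e)`.
online : State → OnlineAlg
online s hist = value (foldl step s hist)

set-same : ∀ u U s → set u U s u ≡ U
set-same u U s with u ℕ.≟ u
... | yes _   = refl
... | no u≢u = ⊥-elim (u≢u refl)

set-other : ∀ u U s w → w ≢ u → set u U s w ≡ s w
set-other u U s w w≢u with w ℕ.≟ u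
... | yes w≡u = ⊥-elim (w≢u w≡u)
... | no _    = refl

step-left : ∀ s u v → step s (u , v) u ≡ grow (s u) (shareˡ s (u , v)) (shareʳ s (u , v))
step-left s u v = set-same u _ _

step-right : ∀ s u v → u ≢ v →
    step s (u , v) v ≡ grow (s v) (shareʳ s (u , v)) (shareˡ s (u , v))
step-right s u v u≢v = trans (set-other u _ _ v (≢-sym u≢v)) (set-same v _ s)

point : ℕ → ℚ√5 → ℕ → ℚ√5
point u p w with w ℕ.≟ u
... | yes _ = p
... | no _  = zero√5

point-same : ∀ u p → point u p u ≡ p
point-same u p with u ℕ.≟ u
... | yes _   = refl
... | no u≢u = ⊥-elim (u≢u refl)

point-other : ∀ u p w → w ≢ u → point u p w ≡ zero√5
point-other u p w w≢u with w ℕ.≟ u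
... | yes w≡u = ⊥-elim (w≢u w≡u)
... | no _    = refl

point-nonNeg : ∀ u p w → NonNeg p → NonNeg (point u p w)
point-nonNeg u p w 0≤p with w ℕ.≟ u
... | yes _ = 0≤p
... | no _  = closed zero√5

-- The case split on w is made once here; P also takes the index, so that a claim can compare w
-- before and after the arrival.
step-elim : (P : ℕ → Vertex → Set) (s : State) (u v : ℕ) → u ≢ v →
  P u (grow (s u) (shareˡ s (u , v)) (shareʳ s (u , v))) →
  P v (grow (s v) (shareʳ s (u , v)) (shareˡ s (u , v))) →
  (∀ w → w ≢ u → w ≢ v → P w (s w)) →
  ∀ w → P w (step s (u , v) w)
step-elim P s u v u≢v Pu Pv Pw w with w ℕ.≟ u
... | yes refl = Pu
... | no w≢u with w ℕ.≟ v
...   | yes refl = Pv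
...   | no w≢v   = Pw w w≢u w≢v

step-dual : ∀ s u v → u ≢ v → ∀ w → dual (step s (u , v) w) ≡
  dual (s w) ⊕ (point u (shareˡ s (u , v)) w ⊕ point v (shareʳ s (u , v)) w)
step-dual s u v u≢v = step-elim (λ w W → dual W ≡ dual (s w) ⊕ (point u p w ⊕ point v q w)) s u v u≢v
  (trans (dual-grow (s u) p q) (cong (dual (s u) ⊕_) (sym (trans
    (cong₂ _⊕_ (point-same u p) (point-other v q u u≢v)) (⊕-identityʳ p)))))
  (trans (dual-grow (s v) q p) (cong (dual (s v) ⊕_) (sym (trans
    (cong₂ _⊕_ (point-other u p v (≢-sym u≢v)) (point-same v q)) (⊕-identityˡ q)))))
  (λ w w≢u w≢v → sym (trans (cong (dual (s w) ⊕_) (cong₂ _⊕_ (point-other u p w w≢u) (point-other v q w w≢v)))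
    (⊕-identityʳ (dual (s w)))))
  where
  p q : ℚ√5
  p = shareˡ s (u , v)
  q = shareʳ s (u , v)

vertexLoad : Vertex → ℚ√5
vertexLoad U = dual U ⊕ rest U

load-∷ : ∀ w e y ys → Incident w e → load w ((e , y) ∷ ys) ≡ y ⊕ load w ys
load-∷ w e y ys inc with incident? w e
... | yes _    = refl
... | no ¬inc = ⊥-elim (¬inc inc)

vertexLoad-grow : ∀ U p q → vertexLoad (grow U p q) ≡ vertexLoad U ⊕ (p ⊕ q)
vertexLoad-grow U p q = trans (cong₂ _⊕_ (dual-grow U p q) (rest-grow U p q))
  (solve 4 (λ x z p q → (x :+ p) :+ (z :+ q) := (x :+ z) :+ (p :+ q)) refl (dual U) (rest U) p q)

-- Conservation: load recorded in the state plus load still to come is unchanged by an arrival.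
step-load : ∀ s u v → u ≢ v → ∀ ys w →
  vertexLoad (s w) ⊕ load w (((u , v) , value s (u , v)) ∷ ys) ≡ vertexLoad (step s (u , v) w) ⊕ load w ys
step-load s u v u≢v ys = step-elim
  (λ w W → vertexLoad (s w) ⊕ load w ((e , y) ∷ ys) ≡ vertexLoad W ⊕ load w ys) s u v u≢v
  (begin
    vertexLoad (s u) ⊕ load u ((e , y) ∷ ys)   ≡⟨ cong (vertexLoad (s u) ⊕_) (load-∷ u e y ys (inj₁ refl)) ⟩
    vertexLoad (s u) ⊕ (y ⊕ load u ys)         ≡⟨ ⊕-assoc (vertexLoad (s u)) y (load u ys) ⟨
    vertexLoad (s u) ⊕ y ⊕ load u ys           ≡⟨ cong (_⊕ load u ys) (vertexLoad-grow (s u) p q) ⟨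
    vertexLoad (grow (s u) p q) ⊕ load u ys    ∎)
  (begin
    vertexLoad (s v) ⊕ load v ((e , y) ∷ ys)   ≡⟨ cong (vertexLoad (s v) ⊕_) (load-∷ v e y ys (inj₂ refl)) ⟩
    vertexLoad (s v) ⊕ (y ⊕ load v ys)         ≡⟨ cong (λ y → vertexLoad (s v) ⊕ (y ⊕ load v ys)) (⊕-comm p q) ⟩
    vertexLoad (s v) ⊕ (q ⊕ p ⊕ load v ys)     ≡⟨ ⊕-assoc (vertexLoad (s v)) (q ⊕ p) (load v ys) ⟨
    vertexLoad (s v) ⊕ (q ⊕ p) ⊕ load v ys     ≡⟨ cong (_⊕ load v ys) (vertexLoad-grow (s v) q p) ⟨
    vertexLoad (grow (s v) q p) ⊕ load v ys    ∎)
  untouched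
  where
  open ≡-Reasoning
  e : Edge
  e = u , v
  p q y : ℚ√5
  p = shareˡ s e
  q = shareʳ s e
  y = value s e
  untouched : ∀ w → w ≢ u → w ≢ v → vertexLoad (s w) ⊕ load w ((e , y) ∷ ys) ≡ vertexLoad (s w) ⊕ load w ys
  untouched w w≢u w≢v with incident? w e
  ... | yes (inj₁ w≡u) = ⊥-elim (w≢u w≡u)
  ... | yes (inj₂ w≡v) = ⊥-elim (w≢v w≡v)
  ... | no _ = refl

-- Sums of dual values over vertex lists

sumOver : (ℕ → ℚ√5) → List ℕ → ℚ√5
sumOver f []      = zero√5
sumOver f (w ∷ S) = f w ⊕ sumOver f S

sumOver-cong : ∀ {f g} → (∀ w → f w ≡ g w) → ∀ S → sumOver f S ≡ sumOver g S
sumOver-cong eq []      = refl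
sumOver-cong eq (w ∷ S) = cong₂ _⊕_ (eq w) (sumOver-cong eq S)

sumOver-⊕ : ∀ f g S → sumOver (λ w → f w ⊕ g w) S ≡ sumOver f S ⊕ sumOver g S
sumOver-⊕ f g []      = sym (⊕-identityʳ zero√5)
sumOver-⊕ f g (w ∷ S) = trans (cong (f w ⊕ g w ⊕_) (sumOver-⊕ f g S))
  (solve 4 (λ a b c d → (a :+ b) :+ (c :+ d) := (a :+ c) :+ (b :+ d))
      refl (f w) (g w) (sumOver f S) (sumOver g S))

sumOver-point-∉ : ∀ u p S → All (u ≢_) S → sumOver (point u p) S ≡ zero√5
sumOver-point-∉ u p [] [] = refl
sumOver-point-∉ u p (w ∷ S) (u≢w ∷ u∉S) =
  trans (cong₂ _⊕_ (point-other u p w (≢-sym u≢w)) (sumOver-point-∉ u p S u∉S)) (⊕-identityʳ zero√5)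

-- Distinctness counts u at most once; the inequality is strict when u lies outside S and p is
-- positive.
sumOver-point : ∀ u p S → NonNeg p → Unique S → sumOver (point u p) S ≼ p
sumOver-point u p [] 0≤p [] = 0≤p because ⊕-identityʳ p
sumOver-point u p (w ∷ S) 0≤p (w∉S ∷ unique) with w ℕ.≟ u
... | yes refl = closed zero√5 because trans
  (cong (λ r → p ⊖ (p ⊕ r)) (sumOver-point-∉ u p S w∉S))
  (solve 1 (λ p → p :- (p :+ con zero√5) := con zero√5) refl p)
... | no _ = subst (_≼ p) (sym (⊕-identityˡ (sumOver (point u p) S))) (sumOver-point u p S 0≤p unique)

step-sum : ∀ s u v → u ≢ v → NonNeg (shareˡ s (u , v)) → NonNeg (shareʳ s (u , v)) → ∀ S →
    Unique S →
  sumOver (dual ∘ step s (u , v)) S ≼ sumOver (dual ∘ s) S ⊕ value s (u , v)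
step-sum s u v u≢v 0≤p 0≤q S unique = subst (_≼ sumOver (dual ∘ s) S ⊕ (p ⊕ q)) (sym (begin
    sumOver (dual ∘ step s (u , v)) S
      ≡⟨ sumOver-cong (step-dual s u v u≢v) S ⟩
    sumOver (λ w → dual (s w) ⊕ (point u p w ⊕ point v q w)) S
      ≡⟨ sumOver-⊕ (dual ∘ s) (λ w → point u p w ⊕ point v q w) S ⟩
    sumOver (dual ∘ s) S ⊕ sumOver (λ w → point u p w ⊕ point v q w) S
      ≡⟨ cong (sumOver (dual ∘ s) S ⊕_) (sumOver-⊕ (point u p) (point v q) S) ⟩
    sumOver (dual ∘ s) S ⊕ (sumOver (point u p) S ⊕ sumOver (point v q) S) ∎))
  (⊕-mono-≼ D D (Pu ⊕ Pv) (p ⊕ q) (≼-refl D)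
    (⊕-mono-≼ Pu p Pv q (sumOver-point u p S 0≤p unique) (sumOver-point v q S 0≤q unique)))
  where
  open ≡-Reasoning
  p q : ℚ√5
  p = shareˡ s (u , v)
  q = shareʳ s (u , v)
  D Pu Pv : ℚ√5
  D  = sumOver (dual ∘ s) S
  Pu = sumOver (point u p) S
  Pv = sumOver (point v q) S

-- Preservation of the invariant along a run

record Ready (s : State) (es : List Edge) : Set where
  field
    safe   : ∀ w → Safe (s w)
    budget : ∀ w → rank (s w) ℕ.+ degree w es ℕ.≤ 3
open Ready

Loopless : Edge → Set
Loopless (u , v) = u ≢ v

degree-incident : ∀ {w} e es → Incident w e → degree w (e ∷ es) ≡ suc (degree w es)
degree-incident {w} e es inc = cong length (filter-accept (incident? w) inc)

degree-other : ∀ {w} e es → ¬ Incident w e → degree w (e ∷ es) ≡ degree w es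
degree-other {w} e es ¬inc = cong length (filter-reject (incident? w) ¬inc)

degree-∷-≤ : ∀ w e es → degree w es ℕ.≤ degree w (e ∷ es)
degree-∷-≤ w e es with incident? w e
... | yes inc = ℕP.≤-trans (ℕP.n≤1+n _) (ℕP.≤-reflexive (sym (degree-incident e es inc)))
... | no ¬inc = ℕP.≤-reflexive (sym (degree-other e es ¬inc))

module Arrival (s : State) (u v : ℕ) (es : List Edge) (u≢v : u ≢ v) (ready : Ready s ((u , v) ∷ es)) where
  private
    e : Edge
    e = u , v
    p q : ℚ√5
    p = shareˡ s e
    q = shareʳ s e

  budget-incident : ∀ w → Incident w e → suc (rank (s w)) ℕ.+ degree w es ℕ.≤ 3
  budget-incident w inc = subst (ℕ._≤ 3)
    (trans (cong (rank (s w) ℕ.+_) (degree-incident e es inc)) (ℕP.+-suc (rank (s w)) (degree w es)))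
    (budget ready w)

  -- The arriving edge itself uses one unit of the degree bound, so neither endpoint is full yet.
  rank≤2 : ∀ w → Incident w e → rank (s w) ℕ.≤ 2
  rank≤2 w inc = ℕP.≤-pred (ℕP.≤-trans (ℕP.m≤m+n _ (degree w es)) (budget-incident w inc))

  sound-step : Sound (s u) (s v) p q
  sound-step = share-sound (s u) (s v) (rank≤2 u (inj₁ refl)) (rank≤2 v (inj₂ refl)) (safe ready u) (safe ready v)

  open Sound sound-step public

  budget-grow : ∀ w a b → Incident w e → rank (grow (s w) a b) ℕ.+ degree w es ℕ.≤ 3
  budget-grow w a b inc = subst (λ r → r ℕ.+ degree w es ℕ.≤ 3)
    (sym (rank-grow (s w) a b (rank≤2 w inc))) (budget-incident w inc)

  ready-step : Ready (step s e) es
  ready-step .safe = step-elim (λ _ → Safe) s u v u≢v safeˡ safeʳ (λ w _ _ → safe ready w)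
  ready-step .budget = step-elim (λ w W → rank W ℕ.+ degree w es ℕ.≤ 3) s u v u≢v
    (budget-grow u p q (inj₁ refl)) (budget-grow v q p (inj₂ refl))
    (λ w _ _ → ℕP.≤-trans (ℕP.+-monoʳ-≤ (rank (s w)) (degree-∷-≤ w e es)) (budget ready w))

  covered-step : c ≼ dual (step s e u) ⊕ dual (step s e v)
  covered-step = subst (c ≼_) (sym (cong₂ _⊕_
    (trans (cong dual (step-left s u v)) (dual-grow (s u) p q))
    (trans (cong dual (step-right s u v u≢v)) (dual-grow (s v) q p)))) covered

  dual-step-mono : ∀ w → dual (s w) ≼ dual (step s e w)
  dual-step-mono w = (point-nonNeg u p w 0≤p +ⁿ point-nonNeg v q w 0≤q) because trans
    (cong (_⊖ dual (s w)) (step-dual s u v u≢v w))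
    (solve 2 (λ x y → x :+ y :- x := y) refl (dual (s w)) (point u p w ⊕ point v q w))

final : State → List Edge → State
final = foldl step

run-online : ∀ s e es → run (online s) (e ∷ es) ≡ (e , value s e) ∷ run (online (step s e)) es
run-online s = run-∷ (online s)

final-safe : ∀ s es → All Loopless es → Ready s es → ∀ w → Safe (final s es w)
final-safe s [] [] ready = safe ready
final-safe s ((u , v) ∷ es) (u≢v ∷ loopless) ready =
    final-safe (step s (u , v)) es loopless ready-step
  where open Arrival s u v es u≢v ready

final-mono : ∀ s es → All Loopless es → Ready s es → ∀ w → dual (s w) ≼ dual (final s es w)
final-mono s [] [] ready w = ≼-refl (dual (s w))
final-mono s ((u , v) ∷ es) (u≢v ∷ loopless) ready w =
  ≼-trans (dual (s w)) (dual (step s (u , v) w)) (dual (final s ((u , v) ∷ es) w))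
    (dual-step-mono w) (final-mono (step s (u , v)) es loopless ready-step w)
  where open Arrival s u v es u≢v ready

-- An edge is covered on arrival, and dual values never decrease afterwards.
final-covers : ∀ s es → All Loopless es → Ready s es → ∀ {a b} → (a , b) ∈ es →
  c ≼ dual (final s es a) ⊕ dual (final s es b)
final-covers s ((u , v) ∷ es) (u≢v ∷ loopless) ready (here refl) =
  ≼-trans c (dual (step s (u , v) u) ⊕ dual (step s (u , v) v)) (dual (t u) ⊕ dual (t v)) covered-step
    (⊕-mono-≼ (dual (step s (u , v) u)) (dual (t u)) (dual (step s (u , v) v)) (dual (t v)) (mono u) (mono v))
  where
  open Arrival s u v es u≢v ready
  t : State
  t = final s ((u , v) ∷ es)
  mono : ∀ w → dual (step s (u , v) w) ≼ dual (t w)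
  mono = final-mono (step s (u , v)) es loopless ready-step
final-covers s ((u , v) ∷ es) (u≢v ∷ loopless) ready (there e∈es) =
  final-covers (step s (u , v)) es loopless ready-step e∈es
  where open Arrival s u v es u≢v ready

run-nonNeg : ∀ s es → All Loopless es → Ready s es → All (λ p →
    zero√5 ≼ proj₂ p) (run (online s) es)
run-nonNeg s [] [] ready = []
run-nonNeg s (e@(u , v) ∷ es) (u≢v ∷ loopless) ready = subst (All _) (sym (run-online s e es))
  (((0≤p +ⁿ 0≤q) because ⊕-identityʳ (value s e)) ∷ run-nonNeg (step s e) es loopless ready-step)
  where open Arrival s u v es u≢v ready

run-load : ∀ s es → All Loopless es → ∀ w →
  vertexLoad (s w) ⊕ load w (run (online s) es) ≡ vertexLoad (final s es w)
run-load s [] [] w = ⊕-identityʳ (vertexLoad (s w))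
run-load s (e@(u , v) ∷ es) (u≢v ∷ loopless) w = begin
  vertexLoad (s w) ⊕ load w (run (online s) (e ∷ es))
    ≡⟨ cong (λ ys → vertexLoad (s w) ⊕ load w ys) (run-online s e es) ⟩
  vertexLoad (s w) ⊕ load w ((e , value s e) ∷ run (online (step s e)) es)
    ≡⟨ step-load s u v u≢v (run (online (step s e)) es) w ⟩
  vertexLoad (step s e w) ⊕ load w (run (online (step s e)) es)
    ≡⟨ run-load (step s e) es loopless w ⟩
  vertexLoad (final s (e ∷ es) w) ∎
  where open ≡-Reasoning

-- Telescopes `step-sum`: each arrival pays for the dual growth it causes, and S may miss some of
-- that growth.
run-total : ∀ s es → All Loopless es → Ready s es → ∀ S → Unique S →
  sumOver (dual ∘ final s es) S ≼ sumOver (dual ∘ s) S ⊕ total (run (online s) es)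
run-total s [] [] ready S unique = ≼-refl (sumOver (dual ∘ s) S) because
  cong (_⊖ sumOver (dual ∘ s) S) (⊕-identityʳ (sumOver (dual ∘ s) S))
run-total s (e@(u , v) ∷ es) (u≢v ∷ loopless) ready S unique =
  (step-sum s u v u≢v 0≤p 0≤q S unique +ⁿ run-total (step s e) es loopless ready-step S unique) because trans
    (cong (λ ys → sumOver (dual ∘ s) S ⊕ total ys ⊖ F) (run-online s e es))
    (solve 5 (λ d y r d′ f → d :+ (y :+ r) :- f := (d :+ y :- d′) :+ (d′ :+ r :- f)) refl
      (sumOver (dual ∘ s) S) (value s e) (total (run (online (step s e)) es)) (sumOver (dual ∘ step s e) S) F)
  where
  open Arrival s u v es u≢v ready
  F : ℚ√5
  F = sumOver (dual ∘ final s (e ∷ es)) S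

-- Weak duality for matchings

endpoints : List Edge → List ℕ
endpoints [] = []
endpoints ((a , b) ∷ M) = a ∷ b ∷ endpoints M

endpoints-fresh : ∀ {a b} M → All (VertexDisjoint (a , b)) M →
  All (a ≢_) (endpoints M) × All (b ≢_) (endpoints M)
endpoints-fresh [] [] = [] , []
endpoints-fresh ((a′ , b′) ∷ M) ((a≢a′ , a≢b′ , b≢a′ , b≢b′) ∷ disjoint) =
  let a∉ , b∉ = endpoints-fresh M disjoint in a≢a′ ∷ a≢b′ ∷ a∉ , b≢a′ ∷ b≢b′ ∷ b∉

endpoints-unique : ∀ M → All Loopless M → AllPairs VertexDisjoint M → Unique (endpoints M)
endpoints-unique [] [] [] = []
endpoints-unique ((a , b) ∷ M) (a≢b ∷ loopless) (disjoint ∷ pairs) =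
  let a∉ , b∉ = endpoints-fresh M disjoint in (a≢b ∷ a∉) ∷ b∉ ∷ endpoints-unique M loopless pairs

-- Normalisation by a gcd blocks computation on a variable n, hence the detour through unnormalised
-- rationals.
suc/1 : ∀ n → + suc n / 1 ≡ 1ℚ Q.+ + n / 1
suc/1 n = QP.toℚᵘ-injective (begin
  Q.toℚᵘ (+ suc n / 1)                       ≈⟨ QP.toℚᵘ-fromℚᵘ (ℚᵘ.mkℚᵘ (+ suc n) 0) ⟩
  ℚᵘ.mkℚᵘ (+ suc n) 0                        ≈⟨ ℚᵘ.*≡* (cong (λ k → (+ 1 ℤ.+ k) ℤ.* + 1) (sym (ℤP.*-identityʳ (+ n)))) ⟩
  ℚᵘ.1ℚᵘ ℚᵘ.+ ℚᵘ.mkℚᵘ (+ n) 0                ≈⟨ ℚᵘP.+-congʳ ℚᵘ.1ℚᵘ (QP.toℚᵘ-fromℚᵘ (ℚᵘ.mkℚᵘ (+ n) 0)) ⟨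
  ℚᵘ.1ℚᵘ ℚᵘ.+ Q.toℚᵘ (+ n / 1)               ≈⟨ QP.toℚᵘ-homo-+ 1ℚ (+ n / 1) ⟨
  Q.toℚᵘ (1ℚ Q.+ + n / 1)                    ∎)
  where open ℚᵘP.≃-Reasoning

c⊛-suc : ∀ n → c ⊛ fromℕ (suc n) ≡ c ⊕ c ⊛ fromℕ n
c⊛-suc n = trans (cong (c ⊛_) (cong₂ _+_√5 (suc/1 n) (sym (QP.+-identityˡ 0ℚ))))
  (solve 2 (λ c n → c :* (con one√5 :+ n) := c :+ c :* n) refl c (fromℕ n))

cover-bound : ∀ (f : ℕ → ℚ√5) M → All (λ (a , b) → c ≼ f a ⊕ f b) M →
  c ⊛ fromℕ (length M) ≼ sumOver f (endpoints M)
cover-bound f [] [] = closed _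
cover-bound f ((a , b) ∷ M) (cov ∷ covs) = (cov +ⁿ cover-bound f M covs) because trans
  (cong (f a ⊕ (f b ⊕ S) ⊖_) (c⊛-suc (length M)))
  (solve 5 (λ a b s c n → a :+ (b :+ s) :- (c :+ n) := (a :+ b :- c) :+ (s :- n)) refl
    (f a) (f b) S c (c ⊛ fromℕ (length M)))
  where
  S : ℚ√5
  S = sumOver f (endpoints M)

degree-take-≤ : ∀ w es t → degree w (take t es) ℕ.≤ degree w es
degree-take-≤ w es zero = z≤n
degree-take-≤ w [] (suc t) = z≤n
degree-take-≤ w (e ∷ es) (suc t) with incident? w e
... | yes inc = subst₂ ℕ._≤_ (sym (degree-incident e (take t es) inc)) (sym (degree-incident e es inc))
  (s≤s (degree-take-≤ w es t))
... | no ¬inc = subst₂ ℕ._≤_ (sym (degree-other e (take t es) ¬inc)) (sym (degree-other e es ¬inc))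
  (degree-take-≤ w es t)

-- Assembly from the empty state

empty : State
empty = const fresh

sumOver-empty : ∀ S → sumOver (dual ∘ empty) S ≡ zero√5
sumOver-empty [] = refl
sumOver-empty (w ∷ S) = trans (⊕-identityˡ (sumOver (dual ∘ empty) S)) (sumOver-empty S)

theorem1 : Σ OnlineAlg (λ alg → (es : List Edge) → SimpleGraphSeq es → MaxDegree≤3 es
    → (t : ℕ) → GuaranteeAt c alg es t)
theorem1 = online empty , λ es (loopless-es , _) deg≤3 t →
  let
    G = take t es
    loopless = AllP.take⁺ t loopless-es
    ready : Ready empty G
    ready = record { safe = λ _ → tt ; budget = λ w → ℕP.≤-trans (degree-take-≤ w es t) (deg≤3 w) }
    ys = run (online empty) G
    ys≡ = run-take (online empty) es t
    loads : ∀ w → load w ys ≡ vertexLoad (final empty G w)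
    loads = λ w → trans (solve 1 (λ l → l := con zero√5 :+ l)
        refl (load w ys)) (run-load empty G loopless w)
    bound : ∀ M → IsMatching G M → c ⊛ fromℕ (length M) ≼ total ys
    bound = λ M (M⊆G , disjoint) →
      -- The endpoints of a matching are distinct, so the dual sum over S lies between c ∣M∣ and the
      -- total value.
      let S = endpoints M in
      ≼-trans (c ⊛ fromℕ (length M)) (sumOver (dual ∘ final empty G) S) (total ys)
        (cover-bound (dual ∘ final empty G) M (All.map (final-covers empty G loopless ready) M⊆G))
        (subst (sumOver (dual ∘ final empty G) S ≼_)
          (trans (cong (_⊕ total ys) (sumOver-empty S)) (⊕-identityˡ (total ys)))
          (run-total empty G loopless ready S (endpoints-unique M (All.map (All.lookup loopless) M⊆G) disjoint)))
  in
    subst (All _) (sym ys≡) (run-nonNeg empty G loopless ready)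
  , (λ w → subst (_≼ one√5) (sym (trans (cong (load w) ys≡) (loads w)))
      (safe-load (final empty G w) (final-safe empty G loopless ready w)))
  , (λ M matching → subst (c ⊛ fromℕ (length M) ≼_) (sym (cong total ys≡)) (bound M matching))
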